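{- Let $B=\{100\}$, and let $A(x,v)$ and $B(x,v,u)$ be the generating functions defined in the context. The generating function $\sum_{n\geq 0}|I_n(100)|\,x^{n+1}$ is equal to $A(x,0)$, and it satisfies $$A(x,0)=\frac{x}{1-x}+x\,B(x,x,1).$$
   Context: For $n\ge 0$, $I_n$ denotes the set of inversion sequences $e=e_0e_1\cdots e_n$, i.e. integer sequences with $0\le e_i\le i$ for each $0\le i\le n$. An inversion sequence contains a pattern $\tau$ if it has a (not necessarily consecutive) subsequence order isomorphic to $\tau$ (including equalities); otherwise it avoids $\tau$. $I_n(\tau)$ is the set of $e\in I_n$ avoiding $\tau$, and $I_n(B)$ the set of those avoiding all patterns in $B$. $\mathcal T(B)$ is the rooted plane tree with root $0$ whose level-$n$ nodes are the elements of $I_n(B)$ (root at level 0), where the parent of $e_0\cdots e_n$ is $e_0\cdots e_{n-1}$ and siblings are ordered left to right by increasing last letter. For a node $e$, $\mathcal T(B;e)$ is the subtree consisting of $e$ and its descendants. The generating function for the number of nodes in $\mathcal T(B;e)$ is the power series in which a node at distance $\ell\ge 0$ below the root $e$ contributes $x^{\ell+1}$. Here $0^m$ is the word of $m$ zeros and $0^mj$ is $0^m$ followed by the letter $j$. Let $A_m(x)$ (for $m\ge1$) and $B_{m,j}(x)$ (for $1\le j\le m$) be the generating functions for the number of nodes in $\mathcal T(B;0^m)$ and $\mathcal T(B;0^mj)$ respectively, and set $$A(x,v)=\sum_{m\ge1}A_m(x)v^{m-1},\qquad B(x,v,u)=\sum_{m\ge1}\sum_{j=1}^m B_{m,j}(x)\,v^{m-1}u^{m-j}.$$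 -}

module Defs where

open import Data.Fin.Base using (Fin; zero; suc; toℕ; opposite)
import Data.Fin.Properties as Fin
open import Data.Integer.Base as ℤ using (ℤ; +_; 0ℤ; 1ℤ)
import Data.Integer.Properties as ℤ
open import Data.List.Base
  using (List; []; _∷_; _∷ʳ_; length; filter; foldr; tabulate; allFin;
         cartesianProductWith)
open import Data.List.Membership.Propositional using (_∈_)
open import Data.List.Membership.Propositional.Properties
  using (∈-cartesianProductWith⁺; ∈-allFin)
open import Data.List.Relation.Binary.Sublist.Propositional as Sublist using (_⊆_; _∷_; minimum)
open import Data.List.Relation.Unary.All as All using (All)
open import Data.List.Relation.Unary.AllPairs using ([]; _∷_)
open import Data.List.Relation.Unary.Any using (here)
open import Data.List.Relation.Unary.Unique.Propositional using (Unique)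
open import Data.List.Relation.Unary.Unique.Propositional.Properties
  using (cartesianProductWith⁺; allFin⁺)
open import Data.Nat.Base as ℕ using (ℕ; zero; suc; _∸_; _<_)
import Data.Nat.Properties as ℕ
open import Data.Product.Base using (∃-syntax; _×_; _,_)
open import Data.Vec.Base as Vec using (Vec; []; _∷_; lookup; fromList; toList)
open import Function.Base using (_∘_)
open import Function.Bundles using (_⇔_; mk⇔; module Equivalence)
open import Relation.Binary.Definitions using (DecidableEquality)
open import Relation.Binary.PropositionalEquality
  using (_≡_; refl; sym; cong; cong₂; module ≡-Reasoning)
open import Relation.Nullary.Decidable using (Dec; yes; no; map′; ¬?; _×-dec_; _→-dec_)
open import Relation.Nullary.Negation using (¬_)
open import Relation.Unary using (Decidable)

open import Algebra.Properties.Semiring.Sum ℤ.+-*-semiring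
  using (sum; sum-cong-≗)

------------------------------------------------------------------------
-- Inversion sequences

-- Sequences of n letters; the letter at position i (counted from 0) is an
-- element of Fin (suc i), i.e. an integer between 0 and i.

infixl 5 _▹_

data InvSeq : ℕ → Set where
  []  : InvSeq 0
  _▹_ : ∀ {n} → InvSeq n → Fin (suc n) → InvSeq (suc n)

-- e₀e₁⋯eₙ has n + 1 letters.
I : ℕ → Set
I n = InvSeq (suc n)

word : ∀ {n} → InvSeq n → List ℕ
word []      = []
word (e ▹ j) = word e ∷ʳ toℕ j

zeros : ∀ m → InvSeq m
zeros zero    = []
zeros (suc m) = zeros m ▹ zero

infix 4 _≟_

_≟_ : ∀ {n} → DecidableEquality (InvSeq n)
[]      ≟ []      = yes refl
(d ▹ i) ≟ (e ▹ j) =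
  map′ (λ (p , q) → cong₂ _▹_ p q) (λ { refl → refl , refl })
       ((d ≟ e) ×-dec (i Fin.≟ j))

allInvSeq : ∀ n → List (InvSeq n)
allInvSeq zero    = [] ∷ []
allInvSeq (suc n) = cartesianProductWith _▹_ (allInvSeq n) (allFin (suc n))

allInvSeq-complete : ∀ {n} (e : InvSeq n) → e ∈ allInvSeq n
allInvSeq-complete []      = here refl
allInvSeq-complete (e ▹ j) =
  ∈-cartesianProductWith⁺ _▹_ (allInvSeq-complete e) (∈-allFin j)

allInvSeq-unique : ∀ n → Unique (allInvSeq n)
allInvSeq-unique zero    = All.[] ∷ []
allInvSeq-unique (suc n) =
  cartesianProductWith⁺ _▹_ (λ { refl → refl , refl })
    (allInvSeq-unique n) (allFin⁺ (suc n))

------------------------------------------------------------------------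
-- Pattern containment

OrderIsomorphic : ∀ {k} → Vec ℕ k → Vec ℕ k → Set
OrderIsomorphic s t = ∀ i j →
  (lookup s i < lookup s j ⇔ lookup t i < lookup t j) ×
  (lookup s i ≡ lookup s j ⇔ lookup t i ≡ lookup t j)

-- _⊆_ is the (not necessarily contiguous) subsequence relation.
Contains : List ℕ → List ℕ → Set
Contains τ w =
  ∃[ s ] toList s ⊆ w × OrderIsomorphic {length τ} s (fromList τ)

Avoids : List (List ℕ) → List ℕ → Set
Avoids P w = All (λ τ → ¬ Contains τ w) P

⇔-dec : ∀ {A B : Set} → Dec A → Dec B → Dec (A ⇔ B)
⇔-dec a? b? =
  map′ (λ (f , g) → mk⇔ f g)
       (λ e → Equivalence.to e , Equivalence.from e)
       ((a? →-dec b?) ×-dec (b? →-dec a?))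

orderIsomorphic? : ∀ {k} (s t : Vec ℕ k) → Dec (OrderIsomorphic s t)
orderIsomorphic? s t = Fin.all? λ i → Fin.all? λ j →
  ⇔-dec (lookup s i ℕ.<? lookup s j) (lookup t i ℕ.<? lookup t j) ×-dec
  ⇔-dec (lookup s i ℕ.≟ lookup s j) (lookup t i ℕ.≟ lookup t j)

anySubsequence? : ∀ {k} {Q : Vec ℕ k → Set} → Decidable Q →
                  ∀ w → Dec (∃[ s ] toList s ⊆ w × Q s)
anySubsequence? {zero} Q? w =
  map′ (λ q → [] , minimum w , q) (λ { ([] , _ , q) → q }) (Q? [])
anySubsequence? {suc k} Q? [] = no λ { (_ ∷ _ , () , _) }
anySubsequence? {suc k} Q? (x ∷ w)
  with anySubsequence? (Q? ∘ (x ∷_)) w | anySubsequence? Q? w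
... | yes (s , s⊆w , q) | _                 = yes (x ∷ s , refl ∷ s⊆w , q)
... | no _              | yes (s , s⊆w , q) = yes (s , x Sublist.∷ʳ s⊆w , q)
... | no ¬here          | no ¬there         = no λ
  { (_ ∷ _ , _ Sublist.∷ʳ s⊆w , q) → ¬there (_ , s⊆w , q)
  ; (_ ∷ s , refl ∷ s⊆w , q)       → ¬here (s , s⊆w , q) }

contains? : ∀ τ w → Dec (Contains τ w)
contains? τ = anySubsequence? λ s → orderIsomorphic? s (fromList τ)

avoids? : ∀ P w → Dec (Avoids P w)
avoids? P w = All.all? (λ τ → ¬? (contains? τ w)) P

------------------------------------------------------------------------
-- The tree 𝒯(P) for a list P of patterns

-- All elements of Iₙ(P), without repetition.
levelNodes : List (List ℕ) → ∀ n → List (I n)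
levelNodes P n = filter (avoids? P ∘ word) (allInvSeq (suc n))

parent : ∀ {n} → I (suc n) → I n
parent (e ▹ _) = e

ancestor : ∀ {n} ℓ → I (ℓ ℕ.+ n) → I n
ancestor zero    e = e
ancestor (suc ℓ) e = ancestor ℓ (parent e)

-- The nodes of 𝒯(P;e) at distance ℓ below e.
subtreeLevel : List (List ℕ) → ∀ {n} → I n → ∀ ℓ → List (I (ℓ ℕ.+ n))
subtreeLevel P {n} e ℓ =
  filter (λ d → ancestor ℓ d ≟ e) (levelNodes P (ℓ ℕ.+ n))

------------------------------------------------------------------------
-- Formal power series in x with integer coefficients

Series : Set
Series = ℕ → ℤ

infix  4 _≈_
infixl 6 _+_ _-_
infixl 7 _*_ _/_
infixr 8 _^_

_≈_ : Series → Series → Set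
f ≈ g = ∀ n → f n ≡ g n

0# 1# x : Series
0# _ = 0ℤ
1# zero    = 1ℤ
1# (suc _) = 0ℤ
x zero    = 0ℤ
x (suc n) = 1# n

_+_ _-_ _*_ : Series → Series → Series
(f + g) n = f n ℤ.+ g n
(f - g) n = f n ℤ.- g n
(f * g) n = sum {suc n} λ i → f (toℕ i) ℤ.* g (n ∸ toℕ i)

_^_ : Series → ℕ → Series
f ^ zero  = 1#
f ^ suc k = f * f ^ k

-- For a series f with constant term 1, f⁻¹ = Σ gₙ xⁿ where g₀ = 1 and
-- gₙ₊₁ = - Σ_{i ≤ n} fᵢ₊₁ gₙ₋ᵢ.  The vector holds gₙ, gₙ₋₁, …, g₀.
inverseCoeffs : Series → ∀ n → Vec ℤ (suc n)
inverseCoeffs f zero    = 1ℤ ∷ []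
inverseCoeffs f (suc n) =
  ℤ.- sum {suc n} (λ i → f (suc (toℕ i)) ℤ.* lookup (inverseCoeffs f n) i)
  ∷ inverseCoeffs f n

inverse : Series → Series
inverse f n = Vec.head (inverseCoeffs f n)

-- Meaningful when g has constant term 1.
_/_ : Series → Series → Series
f / g = f * inverse g

lookup-inverseCoeffs : ∀ f n (i : Fin (suc n)) →
                       lookup (inverseCoeffs f n) i ≡ inverse f (n ∸ toℕ i)
lookup-inverseCoeffs f zero    zero    = refl
lookup-inverseCoeffs f (suc n) zero    = refl
lookup-inverseCoeffs f (suc n) (suc i) = lookup-inverseCoeffs f n i

*-inverseʳ : ∀ f → f 0 ≡ 1ℤ → f * inverse f ≈ 1#
*-inverseʳ f f₀≡1 zero    rewrite f₀≡1 = refl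
*-inverseʳ f f₀≡1 (suc n) = begin
  f 0 ℤ.* (ℤ.- s) ℤ.+ t    ≡⟨ cong (λ c → c ℤ.* (ℤ.- s) ℤ.+ t) f₀≡1 ⟩
  1ℤ ℤ.* (ℤ.- s) ℤ.+ t     ≡⟨ cong₂ ℤ._+_ (ℤ.*-identityˡ (ℤ.- s)) t≡s ⟩
  ℤ.- s ℤ.+ s              ≡⟨ ℤ.+-inverseˡ s ⟩
  0ℤ                       ∎
  where
  open ≡-Reasoning
  s t : ℤ
  s = sum {suc n} λ i → f (suc (toℕ i)) ℤ.* lookup (inverseCoeffs f n) i
  t = sum {suc n} λ i → f (suc (toℕ i)) ℤ.* inverse f (n ∸ toℕ i)
  t≡s : t ≡ s
  t≡s = sum-cong-≗ {suc n} λ i →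
    cong (f (suc (toℕ i)) ℤ.*_) (sym (lookup-inverseCoeffs f n i))

------------------------------------------------------------------------
-- Series in v, and in v and u, over ℤ[[x]]

-- c₀ + c₁ u + c₂ u² + ⋯ is represented by the list of its coefficients.
Polynomial : Set
Polynomial = List Series

evaluate : Polynomial → Series → Series
evaluate p a = foldr (λ c r → c + a * r) 0# p

-- F k is the coefficient of vᵏ.
infixl 9 _[v≔_] _[u≔_]

_[u≔_] : (ℕ → Polynomial) → Series → (ℕ → Series)
(F [u≔ a ]) k = evaluate (F k) a

-- Σₖ Fₖ aᵏ for a series a with zero constant term.  Then aᵏ is divisible
-- by xᵏ, so only the terms with k ≤ n contribute to the coefficient of xⁿ.
_[v≔_] : (ℕ → Series) → Series → Series
(F [v≔ a ]) n = sum {suc n} λ k → (F (toℕ k) * a ^ toℕ k) n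

------------------------------------------------------------------------
-- Generating functions

nodesGF : List (List ℕ) → ∀ {n} → I n → Series
nodesGF P e zero    = 0ℤ
nodesGF P e (suc ℓ) = + length (subtreeLevel P e ℓ)

-- Σ_{n ≥ 0} |Iₙ(P)| xⁿ⁺¹
invSeqGF : List (List ℕ) → Series
invSeqGF P zero    = 0ℤ
invSeqGF P (suc n) = + length (levelNodes P n)

-- The coefficient of vᵏ is A_{k+1}.
A : List (List ℕ) → ℕ → Series
A P k = nodesGF P (zeros (suc k))

-- The coefficient of vᵏ is Σ_{j=1}^{m} B_{m,j} u^{m-j} with m = k + 1.  The
-- coefficient of uⁱ is thus B_{m,m-i}, and toℕ (suc (opposite i)) = m - i.
B : List (List ℕ) → ℕ → Polynomial
B P k = tabulate {n = m} λ i → nodesGF P (zeros m ▹ suc (opposite i))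
  where
  m : ℕ
  m = suc k

{-# OPTIONS --safe #-}
module Submission where

-- The subtree below the root 0 is the whole tree, and setting v = 0 leaves
-- only the coefficient A₁; this is the first equation.
--
-- For the second equation, an element of Iₙ₊₁ is its parent followed by one
-- more letter, so the nodes at distance ℓ + 1 below e are exactly the nodes
-- at distance ℓ below the children of e (nodesGF-children).  The word 0ᵐ
-- avoids 100, and its children are 0ᵐ⁺¹ and 0ᵐj for 1 ≤ j ≤ m, whence
--
--   Aₘ = x + x Aₘ₊₁ + x (Bₘ,₁ + ⋯ + Bₘ,ₘ).
--
-- Iterating from m = 1 gives A₁ = (x + x² + ⋯) + x Σₘ xᵐ⁻¹ Σⱼ Bₘ,ⱼ, which is
-- the claim.  The iteration is carried out one coefficient at a time
-- (solve-recurrence): the coefficient of xⁿ only involves finitely many steps.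
-- Nothing about 100 is used beyond the fact that every 0ᵐ avoids it, so the
-- equation holds for every set of patterns with this property (A-expansion).

open import Data.List.Base using ([]; _∷_)
open import Data.Product.Base using (_×_)
open import Defs using (_≈_; _+_; _-_; _*_; _/_; 0#; 1#; x; _[v≔_]; _[u≔_]; A; B; invSeqGF)

open import Defs
  using (InvSeq; []; _▹_; I; word; zeros; _≟_; allInvSeq; allInvSeq-complete;
         allInvSeq-unique; Contains; Avoids; avoids?; levelNodes; parent;
         ancestor; Series; evaluate; _^_; inverse; inverseCoeffs;
         lookup-inverseCoeffs; subtreeLevel; nodesGF)
open import Data.Bool.Base using (if_then_else_)
open import Data.Fin.Base using (Fin; zero; suc; toℕ; opposite)
open import Data.Fin.Permutation using (reverse)
open import Data.Integer.Base as ℤ using (ℤ; +_; 0ℤ; 1ℤ)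
import Data.Integer.Properties as ℤ
open import Data.List.Base
  using (List; _++_; map; length; filter; allFin; cartesianProductWith; tabulate)
open import Data.List.Membership.Propositional using (_∈_)
import Data.List.Properties as List
open import Data.List.Relation.Binary.Sublist.Propositional.Properties
  using (All-resp-⊆)
open import Data.List.Relation.Unary.All as All using (All; []; _∷_)
import Data.List.Relation.Unary.All.Properties as All
open import Data.List.Relation.Unary.AllPairs using (_∷_)
open import Data.List.Relation.Unary.Any using (here; there)
open import Data.List.Relation.Unary.Unique.Propositional using (Unique)
open import Data.Nat.Base as ℕ using (ℕ; zero; suc; _∸_; z<s)
import Data.Nat.Properties as ℕ
open import Data.Nat.ListAction using (sum)
open import Data.Nat.ListAction.Properties using (sum-++)
open import Data.Product.Base using (_,_; proj₁)
open import Data.Vec.Base using ([]; _∷_; lookup)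
open import Function.Base using (_∘_; id)
open import Function.Bundles using (module Equivalence)
open import Relation.Binary.Definitions using (DecidableEquality)
open import Relation.Binary.PropositionalEquality
  using (_≡_; refl; sym; trans; cong; cong₂; module ≡-Reasoning)
open import Relation.Nullary.Decidable using (Dec; yes; no; does)
open import Relation.Nullary.Negation using (¬_; contradiction)
open import Relation.Unary using (Decidable)

open import Algebra.Properties.Semiring.Sum ℤ.+-*-semiring
  using (sum-cong-≗; sum-permute; sum-replicate-zero) renaming (sum to ∑)

open ≡-Reasoning

------------------------------------------------------------------------
-- Finite sums over filtered lists

∑-zero : ∀ n {f : Fin n → ℤ} → (∀ i → f i ≡ 0ℤ) → ∑ f ≡ 0ℤ
∑-zero n f≡0 = trans (sum-cong-≗ f≡0) (sum-replicate-zero n)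

+-sum-tabulate : ∀ {n} (f : Fin n → ℕ) → + sum (tabulate f) ≡ ∑ (+_ ∘ f)
+-sum-tabulate {zero}  f = refl
+-sum-tabulate {suc n} f = cong (ℤ._+_ (+ f zero)) (+-sum-tabulate (f ∘ suc))

-- The indicator function of a decidable predicate.
𝟙 : ∀ {X : Set} {Q : X → Set} → Decidable Q → X → ℕ
𝟙 Q? a = if does (Q? a) then 1 else 0

length-filter-filter : ∀ {X : Set} {Q R : X → Set}
  (Q? : Decidable Q) (R? : Decidable R) (as : List X) →
  length (filter Q? (filter R? as)) ≡ sum (map (𝟙 R?) (filter Q? as))
length-filter-filter Q? R? [] = refl
length-filter-filter Q? R? (a ∷ as) with R? a in R?a | Q? a in Q?a
... | yes _ | yes _ rewrite Q?a | R?a =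
  cong suc (length-filter-filter Q? R? as)
... | yes _ | no _  rewrite Q?a       = length-filter-filter Q? R? as
... | no _  | yes _ rewrite R?a       = length-filter-filter Q? R? as
... | no _  | no _                    = length-filter-filter Q? R? as

filter-≟ : ∀ {X : Set} (_≟ˣ_ : DecidableEquality X) {a as} →
  Unique as → a ∈ as → filter (_≟ˣ a) as ≡ a ∷ []
filter-≟ _≟ˣ_ (a∉as ∷ _) (here refl) =
  trans (List.filter-accept (_≟ˣ _) refl)
        (cong (_ ∷_) (List.filter-none (_≟ˣ _) (All.map (_∘ sym) a∉as)))
filter-≟ _≟ˣ_ (b∉as ∷ u) (there a∈as) =
  trans (List.filter-reject (_≟ˣ _) (All.lookup b∉as a∈as))
        (filter-≟ _≟ˣ_ u a∈as)

------------------------------------------------------------------------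
-- Counting descendants through children

-- A weight attached to every inversion sequence, of whatever length.
Weight : Set
Weight = ∀ {n} → InvSeq n → ℕ

-- The total weight of the children of e.
childSum : Weight → Weight
childSum f {n} e = sum (tabulate {n = suc n} λ j → f (e ▹ j))

-- The total weight of the descendants of e at distance ℓ, where every
-- inversion sequence, avoiding or not, is a descendant of its prefixes.
descendantSum : Weight → ∀ ℓ {n} → I n → ℕ
descendantSum f ℓ {n} e =
  sum (map f (filter (λ d → ancestor ℓ d ≟ e) (allInvSeq (suc (ℓ ℕ.+ n)))))

descendantSum-zero : ∀ (f : Weight) {n} (e : I n) →
                     descendantSum f 0 e ≡ f e
descendantSum-zero f {n} e = begin
  sum (map f (filter (_≟ e) (allInvSeq (suc n))))
    ≡⟨ cong (sum ∘ map f)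
         (filter-≟ _≟_ (allInvSeq-unique (suc n)) (allInvSeq-complete e)) ⟩
  f e ℕ.+ 0
    ≡⟨ ℕ.+-identityʳ (f e) ⟩
  f e ∎

-- A condition on parents selects, together with each selected sequence, the
-- whole block of its children.
sum-filter-parent : ∀ (f : Weight) {n} {Q : I n → Set} (Q? : Decidable Q) ds →
  sum (map f (filter (Q? ∘ parent)
                (cartesianProductWith _▹_ ds (allFin (suc (suc n)))))) ≡
  sum (map (childSum f) (filter Q? ds))
sum-filter-parent f Q? [] = refl
sum-filter-parent f {n} {Q} Q? (d ∷ ds) = begin
  sum (map f (filter Q?′ (block ++ blocks)))
    ≡⟨ cong (sum ∘ map f) (List.filter-++ Q?′ block blocks) ⟩
  sum (map f (filter Q?′ block ++ filter Q?′ blocks))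
    ≡⟨ cong sum (List.map-++ f (filter Q?′ block) (filter Q?′ blocks)) ⟩
  sum (map f (filter Q?′ block) ++ map f (filter Q?′ blocks))
    ≡⟨ sum-++ (map f (filter Q?′ block)) (map f (filter Q?′ blocks)) ⟩
  sum (map f (filter Q?′ block)) ℕ.+ sum (map f (filter Q?′ blocks))
    ≡⟨ cong (sum (map f (filter Q?′ block)) ℕ.+_) (sum-filter-parent f Q? ds) ⟩
  sum (map f (filter Q?′ block)) ℕ.+ sum (map (childSum f) (filter Q? ds))
    ≡⟨ first-block (Q? d) ⟩
  sum (map (childSum f) (filter Q? (d ∷ ds))) ∎
  where
  Q?′ : Decidable (Q ∘ parent)
  Q?′ = Q? ∘ parent
  js     = allFin (suc (suc n))
  block  = map (d ▹_) js
  blocks = cartesianProductWith _▹_ ds js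

  sum-block : sum (map f block) ≡ childSum f d
  sum-block = cong sum (trans (sym (List.map-∘ {g = f} {f = d ▹_} js))
                              (List.map-tabulate id (f ∘ (d ▹_))))

  first-block : Dec (Q d) →
    sum (map f (filter Q?′ block)) ℕ.+ sum (map (childSum f) (filter Q? ds)) ≡
    sum (map (childSum f) (filter Q? (d ∷ ds)))
  first-block (yes q) = begin
    sum (map f (filter Q?′ block)) ℕ.+ sum (map (childSum f) (filter Q? ds))
      ≡⟨ cong (λ as → sum (map f as) ℕ.+ sum (map (childSum f) (filter Q? ds)))
           (List.filter-all Q?′ (All.map⁺ (All.universal (λ _ → q) js))) ⟩
    sum (map f block) ℕ.+ sum (map (childSum f) (filter Q? ds))
      ≡⟨ cong (ℕ._+ sum (map (childSum f) (filter Q? ds))) sum-block ⟩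
    sum (map (childSum f) (d ∷ filter Q? ds))
      ≡⟨ cong (sum ∘ map (childSum f)) (List.filter-accept Q? q) ⟨
    sum (map (childSum f) (filter Q? (d ∷ ds))) ∎
  first-block (no ¬q) = begin
    sum (map f (filter Q?′ block)) ℕ.+ sum (map (childSum f) (filter Q? ds))
      ≡⟨ cong (λ as → sum (map f as) ℕ.+ sum (map (childSum f) (filter Q? ds)))
           (List.filter-none Q?′ (All.map⁺ (All.universal (λ _ → ¬q) js))) ⟩
    sum (map (childSum f) (filter Q? ds))
      ≡⟨ cong (sum ∘ map (childSum f)) (List.filter-reject Q? ¬q) ⟨
    sum (map (childSum f) (filter Q? (d ∷ ds))) ∎

descendantSum-childSum : ∀ (f : Weight) ℓ {n} (e : I n) →
  descendantSum f (suc ℓ) e ≡ descendantSum (childSum f) ℓ e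
descendantSum-childSum f ℓ {n} e =
  sum-filter-parent f (λ d → ancestor ℓ d ≟ e) (allInvSeq (suc (ℓ ℕ.+ n)))

-- Descending one letter at the end may be traded for descending one letter
-- at the start.
descendantSum-suc : ∀ (f : Weight) ℓ {n} (e : I n) →
  descendantSum f (suc ℓ) e ≡ sum (tabulate λ j → descendantSum f ℓ (e ▹ j))
descendantSum-suc f zero e = begin
  descendantSum f 1 e
    ≡⟨ descendantSum-childSum f 0 e ⟩
  descendantSum (childSum f) 0 e
    ≡⟨ descendantSum-zero (childSum f) e ⟩
  sum (tabulate λ j → f (e ▹ j))
    ≡⟨ cong sum (List.tabulate-cong λ j → descendantSum-zero f (e ▹ j)) ⟨
  sum (tabulate λ j → descendantSum f 0 (e ▹ j)) ∎
descendantSum-suc f (suc ℓ) e = begin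
  descendantSum f (suc (suc ℓ)) e
    ≡⟨ descendantSum-childSum f (suc ℓ) e ⟩
  descendantSum (childSum f) (suc ℓ) e
    ≡⟨ descendantSum-suc (childSum f) ℓ e ⟩
  sum (tabulate λ j → descendantSum (childSum f) ℓ (e ▹ j))
    ≡⟨ cong sum (List.tabulate-cong λ j → descendantSum-childSum f ℓ (e ▹ j)) ⟨
  sum (tabulate λ j → descendantSum f (suc ℓ) (e ▹ j)) ∎

------------------------------------------------------------------------
-- Generating functions of subtrees

-- 1 on the sequences that avoid every pattern in P, and 0 on the others.
avoidance : List (List ℕ) → Weight
avoidance P = 𝟙 (avoids? P ∘ word)

length-subtreeLevel : ∀ P {n} (e : I n) ℓ →
  length (subtreeLevel P e ℓ) ≡ descendantSum (avoidance P) ℓ e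
length-subtreeLevel P {n} e ℓ =
  length-filter-filter (λ d → ancestor ℓ d ≟ e) (avoids? P ∘ word)
    (allInvSeq (suc (ℓ ℕ.+ n)))

nodesGF-one : ∀ P {n} (e : I n) → Avoids P (word e) → nodesGF P e 1 ≡ 1ℤ
nodesGF-one P e av = cong +_ (begin
  length (subtreeLevel P e 0)         ≡⟨ length-subtreeLevel P e 0 ⟩
  descendantSum (avoidance P) 0 e     ≡⟨ descendantSum-zero (avoidance P) e ⟩
  avoidance P e                       ≡⟨ avoidance≡1 ⟩
  1                                   ∎)
  where
  avoidance≡1 : avoidance P e ≡ 1
  avoidance≡1 with avoids? P (word e)
  ... | yes _   = refl
  ... | no  ¬av = contradiction av ¬av

nodesGF-children : ∀ P {n} (e : I n) ℓ →
  nodesGF P e (suc (suc ℓ)) ≡ ∑ λ j → nodesGF P (e ▹ j) (suc ℓ)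
nodesGF-children P e ℓ = begin
  + length (subtreeLevel P e (suc ℓ))
    ≡⟨ cong +_ (length-subtreeLevel P e (suc ℓ)) ⟩
  + descendantSum (avoidance P) (suc ℓ) e
    ≡⟨ cong +_ (descendantSum-suc (avoidance P) ℓ e) ⟩
  + sum (tabulate λ j → descendantSum (avoidance P) ℓ (e ▹ j))
    ≡⟨ +-sum-tabulate (λ j → descendantSum (avoidance P) ℓ (e ▹ j)) ⟩
  ∑ (λ j → + descendantSum (avoidance P) ℓ (e ▹ j))
    ≡⟨ sum-cong-≗ (λ j → cong +_ (length-subtreeLevel P (e ▹ j) ℓ)) ⟨
  ∑ (λ j → + length (subtreeLevel P (e ▹ j) ℓ)) ∎

-- The root is the only inversion sequence of one letter, hence the ancestor
-- of every node.
root-unique : (d e : I 0) → d ≡ e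
root-unique ([] ▹ zero) ([] ▹ zero) = refl

invSeqGF≈nodesGF-root : ∀ P → invSeqGF P ≈ nodesGF P (zeros 1)
invSeqGF≈nodesGF-root P zero    = refl
invSeqGF≈nodesGF-root P (suc n) = cong +_ (begin
  length (levelNodes P n)
    ≡⟨ cong (length ∘ levelNodes P) (ℕ.+-identityʳ n) ⟨
  length (levelNodes P (n ℕ.+ 0))
    ≡⟨ cong length (List.filter-all (λ d → ancestor n d ≟ zeros 1)
         (All.universal (λ d → root-unique (ancestor n d) (zeros 1))
           (levelNodes P (n ℕ.+ 0)))) ⟨
  length (subtreeLevel P (zeros 1) n) ∎)

------------------------------------------------------------------------
-- Power series

-- The product satisfies (f * g) (suc n) = f 0 * g (suc n) + (f⁺ * g) n by
-- definition, where f⁺ n = f (suc n).  The inductions below rely on this.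

*-zeroˡ : ∀ f → 0# * f ≈ 0#
*-zeroˡ f n = ∑-zero (suc n) λ i → ℤ.*-zeroˡ (f (n ∸ toℕ i))

*-zeroʳ : ∀ f {g} → g ≈ 0# → f * g ≈ 0#
*-zeroʳ f g≈0 n = ∑-zero (suc n) λ i →
  trans (cong (f (toℕ i) ℤ.*_) (g≈0 (n ∸ toℕ i))) (ℤ.*-zeroʳ (f (toℕ i)))

*-identityˡ : ∀ f → 1# * f ≈ f
*-identityˡ f zero    = trans (ℤ.+-identityʳ _) (ℤ.*-identityˡ (f 0))
*-identityˡ f (suc n) = begin
  1ℤ ℤ.* f (suc n) ℤ.+ (0# * f) n  ≡⟨ cong₂ ℤ._+_ (ℤ.*-identityˡ (f (suc n))) (*-zeroˡ f n) ⟩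
  f (suc n) ℤ.+ 0ℤ                 ≡⟨ ℤ.+-identityʳ (f (suc n)) ⟩
  f (suc n)                        ∎

*-identityʳ : ∀ f → f * 1# ≈ f
*-identityʳ f zero    = trans (ℤ.+-identityʳ _) (ℤ.*-identityʳ (f 0))
*-identityʳ f (suc n) = begin
  f 0 ℤ.* 0ℤ ℤ.+ ((f ∘ suc) * 1#) n  ≡⟨ cong₂ ℤ._+_ (ℤ.*-zeroʳ (f 0)) (*-identityʳ (f ∘ suc) n) ⟩
  0ℤ ℤ.+ f (suc n)                   ≡⟨ ℤ.+-identityˡ (f (suc n)) ⟩
  f (suc n)                          ∎

x*-zero : ∀ f → (x * f) 0 ≡ 0ℤ
x*-zero f = trans (ℤ.+-identityʳ _) (ℤ.*-zeroˡ (f 0))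

x*-suc : ∀ f n → (x * f) (suc n) ≡ f n
x*-suc f n = begin
  0ℤ ℤ.* f (suc n) ℤ.+ (1# * f) n  ≡⟨ cong₂ ℤ._+_ (ℤ.*-zeroˡ (f (suc n))) (*-identityˡ f n) ⟩
  0ℤ ℤ.+ f n                       ≡⟨ ℤ.+-identityˡ (f n) ⟩
  f n                              ∎

*x*-suc : ∀ f g n → (f * (x * g)) (suc n) ≡ (f * g) n
*x*-suc f g zero = cong₂ ℤ._+_ (cong (f 0 ℤ.*_) (x*-suc g 0))
  (trans (ℤ.+-identityʳ _)
    (trans (cong (f 1 ℤ.*_) (x*-zero g)) (ℤ.*-zeroʳ (f 1))))
*x*-suc f g (suc n) =
  cong₂ ℤ._+_ (cong (f 0 ℤ.*_) (x*-suc g (suc n))) (*x*-suc (f ∘ suc) g n)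

inverse-1-x : ∀ n → inverse (1# - x) n ≡ 1ℤ
inverse-1-x zero    = refl
inverse-1-x (suc n) = begin
  ℤ.- (ℤ.- 1ℤ ℤ.* c zero ℤ.+ ∑ (λ i → 0ℤ ℤ.* c (suc i)))
    ≡⟨ cong₂ (λ a b → ℤ.- (ℤ.- 1ℤ ℤ.* a ℤ.+ b))
         (trans (lookup-inverseCoeffs (1# - x) n zero) (inverse-1-x n))
         (∑-zero n λ i → ℤ.*-zeroˡ (c (suc i))) ⟩
  1ℤ ∎
  where
  c : Fin (suc n) → ℤ
  c = lookup (inverseCoeffs (1# - x) n)

x/[1-x]-suc : ∀ n → (x / (1# - x)) (suc n) ≡ 1ℤ
x/[1-x]-suc n = trans (x*-suc (inverse (1# - x)) n) (inverse-1-x n)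

------------------------------------------------------------------------
-- Substitution

[v≔0] : ∀ F → F [v≔ 0# ] ≈ F 0
[v≔0] F n = begin
  (F 0 * 1#) n ℤ.+ ∑ {n} (λ k → (F (suc (toℕ k)) * (0# * 0# ^ toℕ k)) n)
    ≡⟨ cong₂ ℤ._+_ (*-identityʳ (F 0) n)
         (∑-zero n λ k → *-zeroʳ (F (suc (toℕ k))) (*-zeroˡ (0# ^ toℕ k)) n) ⟩
  F 0 n ℤ.+ 0ℤ
    ≡⟨ ℤ.+-identityʳ (F 0 n) ⟩
  F 0 n ∎

[v≔x]-zero : ∀ F → (F [v≔ x ]) 0 ≡ F 0 0
[v≔x]-zero F = trans (ℤ.+-identityʳ _) (*-identityʳ (F 0) 0)

-- The coefficientwise form of F(x) = F₀ + x (F₁ + F₂ x + ⋯).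
[v≔x]-suc : ∀ F n →
  (F [v≔ x ]) (suc n) ≡ F 0 (suc n) ℤ.+ ((F ∘ suc) [v≔ x ]) n
[v≔x]-suc F n = cong₂ ℤ._+_ (*-identityʳ (F 0) (suc n))
  (sum-cong-≗ {suc n} λ k → *x*-suc (F (suc (toℕ k))) (x ^ toℕ k) n)

evaluate-at-1 : ∀ {m} (c : Fin m → Series) n →
  evaluate (tabulate c) 1# n ≡ ∑ λ i → c i n
evaluate-at-1 {zero}  c n = refl
evaluate-at-1 {suc m} c n = cong (ℤ._+_ (c zero n))
  (trans (*-identityˡ (evaluate (tabulate (c ∘ suc)) 1#) n)
         (evaluate-at-1 (c ∘ suc) n))

-- If aₖ = x + x aₖ₊₁ + x bₖ for every k, then a₀ = x/(1-x) + x Σₖ bₖ xᵏ.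
-- The hypotheses give this recurrence by coefficients, with bₖ divisible by
-- x.  As k varies in the recurrence, the induction on the coefficient is
-- applied to the shifted sequences.
solve-recurrence : ∀ (a b : ℕ → Series) →
  (∀ k → b k 0 ≡ 0ℤ) → (∀ k → a k 0 ≡ 0ℤ) → (∀ k → a k 1 ≡ 1ℤ) →
  (∀ k n → a k (suc (suc n)) ≡ a (suc k) (suc n) ℤ.+ b k (suc n)) →
  a 0 ≈ x / (1# - x) + x * (b [v≔ x ])
solve-recurrence a b b₀ a₀ a₁ a₂₊ zero =
  trans (a₀ 0) (sym (cong₂ ℤ._+_ (x*-zero (inverse (1# - x))) (x*-zero (b [v≔ x ]))))
solve-recurrence a b b₀ a₀ a₁ a₂₊ (suc n) = begin
  a 0 (suc n)
    ≡⟨ coefficient a b b₀ a₁ a₂₊ n ⟩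
  1ℤ ℤ.+ (b [v≔ x ]) n
    ≡⟨ cong₂ ℤ._+_ (x/[1-x]-suc n) (x*-suc (b [v≔ x ]) n) ⟨
  (x / (1# - x) + x * (b [v≔ x ])) (suc n) ∎
  where
  coefficient : ∀ (a b : ℕ → Series) →
    (∀ k → b k 0 ≡ 0ℤ) → (∀ k → a k 1 ≡ 1ℤ) →
    (∀ k n → a k (suc (suc n)) ≡ a (suc k) (suc n) ℤ.+ b k (suc n)) →
    ∀ n → a 0 (suc n) ≡ 1ℤ ℤ.+ (b [v≔ x ]) n
  coefficient a b b₀ a₁ a₂₊ zero =
    trans (a₁ 0) (sym (cong (ℤ._+_ 1ℤ) (trans ([v≔x]-zero b) (b₀ 0))))
  coefficient a b b₀ a₁ a₂₊ (suc n) = begin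
    a 0 (suc (suc n))
      ≡⟨ a₂₊ 0 n ⟩
    a 1 (suc n) ℤ.+ b 0 (suc n)
      ≡⟨ cong (ℤ._+ b 0 (suc n))
           (coefficient (a ∘ suc) (b ∘ suc) (b₀ ∘ suc) (a₁ ∘ suc) (a₂₊ ∘ suc) n) ⟩
    1ℤ ℤ.+ ((b ∘ suc) [v≔ x ]) n ℤ.+ b 0 (suc n)
      ≡⟨ ℤ.+-assoc 1ℤ (((b ∘ suc) [v≔ x ]) n) (b 0 (suc n)) ⟩
    1ℤ ℤ.+ (((b ∘ suc) [v≔ x ]) n ℤ.+ b 0 (suc n))
      ≡⟨ cong (ℤ._+_ 1ℤ) (ℤ.+-comm (((b ∘ suc) [v≔ x ]) n) (b 0 (suc n))) ⟩
    1ℤ ℤ.+ (b 0 (suc n) ℤ.+ ((b ∘ suc) [v≔ x ]) n)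
      ≡⟨ cong (ℤ._+_ 1ℤ) ([v≔x]-suc b n) ⟨
    1ℤ ℤ.+ (b [v≔ x ]) (suc n) ∎

------------------------------------------------------------------------
-- The recurrence for A

-- B lists the children 0ᵐj with j decreasing, and nodesGF-children with j
-- increasing.
B-at-1 : ∀ P k n → (B P [u≔ 1# ]) k n ≡
         ∑ {suc k} λ j → nodesGF P (zeros (suc k) ▹ suc j) n
B-at-1 P k n = begin
  evaluate (B P k) 1# n
    ≡⟨ evaluate-at-1 (λ i → nodesGF P (zeros (suc k) ▹ suc (opposite i))) n ⟩
  ∑ {suc k} (λ i → nodesGF P (zeros (suc k) ▹ suc (opposite i)) n)
    ≡⟨ sum-permute (λ j → nodesGF P (zeros (suc k) ▹ suc j) n) reverse ⟨
  ∑ {suc k} (λ j → nodesGF P (zeros (suc k) ▹ suc j) n) ∎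

A-suc-suc : ∀ P k n →
  A P k (suc (suc n)) ≡ A P (suc k) (suc n) ℤ.+ (B P [u≔ 1# ]) k (suc n)
A-suc-suc P k n = trans (nodesGF-children P (zeros (suc k)) n)
  (cong (ℤ._+_ (A P (suc k) (suc n))) (sym (B-at-1 P k (suc n))))

A-expansion : ∀ P → (∀ m → Avoids P (word (zeros m))) →
              A P 0 ≈ x / (1# - x) + x * (B P [u≔ 1# ] [v≔ x ])
A-expansion P av = solve-recurrence (A P) (B P [u≔ 1# ])
  (λ k → trans (B-at-1 P k 0) (∑-zero (suc k) λ _ → refl))
  (λ k → refl)
  (λ k → nodesGF-one P (zeros (suc k)) (av (suc k)))
  (A-suc-suc P)

zeros-all-0 : ∀ m → All (_≡ 0) (word (zeros m))
zeros-all-0 zero    = []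
zeros-all-0 (suc m) = All.∷ʳ⁺ (zeros-all-0 m) refl

-- The first letter of an occurrence of 100 exceeds the second.
constant-avoids-100 : ∀ {c w} → All (_≡ c) w → ¬ Contains (1 ∷ 0 ∷ 0 ∷ []) w
constant-avoids-100 w≡c (_ ∷ _ ∷ _ ∷ [] , s⊆w , iso)
  with All-resp-⊆ s⊆w w≡c
... | refl ∷ refl ∷ _ =
  ℕ.<-irrefl refl (Equivalence.from (proj₁ (iso (suc zero) zero)) z<s)

theorem3p2 : let P = (1 ∷ 0 ∷ 0 ∷ []) ∷ [] in
    (invSeqGF P ≈ A P [v≔ 0# ]) ×
    (A P [v≔ 0# ] ≈ x / (1# - x) + x * (B P [u≔ 1# ] [v≔ x ]))
theorem3p2 =
  (λ n → trans (invSeqGF≈nodesGF-root _ n) (sym ([v≔0] (A _) n))) ,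
  (λ n → trans ([v≔0] (A _) n)
           (A-expansion _ (λ m → constant-avoids-100 (zeros-all-0 m) ∷ []) n))
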